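{- The variety of disjointive distributive residuated lattices has an undecidable equational theory, i.e. there is no algorithm that, given two terms $\sigma,\rho$ in the signature $(\land,\lor,\top,\bot,\neg,\cdot,\backslash,/)$ over a countably infinite set of variables, decides whether $\sigma=\rho$ holds in all disjointive distributive residuated lattices.
   Context: A disjointive distributive residuated lattice is an algebra $(A,\land,\lor,\top,\bot,\neg,\cdot,\backslash,/)$ such that $(A,\land,\lor,\top,\bot)$ is a bounded distributive lattice, $(A,\cdot)$ is a semigroup, $\backslash,/$ residuate $\cdot$ (for all $x,y,z\in A$: $x\cdot y\le z$ iff $y\le x\backslash z$ iff $x\le z/y$, where $\le$ is the lattice order), and $x\land\neg x=\bot$ for all $x\in A$ (nothing else is required of $\neg$). -}

module Defs where

open import Algebra.Core using (Op₁; Op₂)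
open import Algebra.Definitions using (Congruent₁; Congruent₂; Identity)
open import Algebra.Lattice.Structures using (IsDistributiveLattice)
open import Algebra.Structures using (IsSemigroup)
open import Data.Bool.Base using (Bool; true; false)
open import Data.Fin.Base using (Fin)
open import Data.List.Base using (List; []; _∷_; _++_; map; replicate)
open import Data.Maybe.Base using (Maybe; just; nothing)
open import Data.Nat.Base using (ℕ)
open import Data.Product.Base using (_×_; _,_; ∃-syntax)
open import Data.Sum.Base using (_⊎_; inj₁)
open import Function.Bundles using (_⇔_)
open import Level using (Level; _⊔_) renaming (suc to lsuc)
open import Relation.Binary.Core using (Rel)
open import Relation.Binary.PropositionalEquality.Core using (_≡_)
open import Relation.Nullary.Negation.Core using (¬_)

record IsDisjointiveDRL {c ℓ} {A : Set c} (_≈_ : Rel A ℓ)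
    (_∧_ _∨_ : Op₂ A) (⊤ ⊥ : A) (∼_ : Op₁ A) (_·_ _\\_ _//_ : Op₂ A)
    : Set (c ⊔ ℓ) where

  _≤_ : Rel A ℓ
  x ≤ y = (x ∧ y) ≈ x

  field
    isDistributiveLattice : IsDistributiveLattice _≈_ _∨_ _∧_
    ∧-identity            : Identity _≈_ ⊤ _∧_
    ∨-identity            : Identity _≈_ ⊥ _∨_
    ·-isSemigroup         : IsSemigroup _≈_ _·_
    \\-cong               : Congruent₂ _≈_ _\\_
    //-cong               : Congruent₂ _≈_ _//_
    \\-residual           : ∀ x y z → ((x · y) ≤ z) ⇔ (y ≤ (x \\ z))
    //-residual           : ∀ x y z → ((x · y) ≤ z) ⇔ (x ≤ (z // y))
    ∼-cong                : Congruent₁ _≈_ ∼_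
    ∼-disjoint            : ∀ x → (x ∧ (∼ x)) ≈ ⊥

record DisjointiveDRL (c ℓ : Level) : Set (lsuc (c ⊔ ℓ)) where
  infix  8 ∼_
  infixl 7 _·_
  infixr 6 _\\_
  infixl 6 _//_
  infixr 5 _∧_
  infixr 4 _∨_
  infix  3 _≈_
  field
    Carrier          : Set c
    _≈_              : Rel Carrier ℓ
    _∧_ _∨_          : Op₂ Carrier
    ⊤ ⊥              : Carrier
    ∼_               : Op₁ Carrier
    _·_ _\\_ _//_    : Op₂ Carrier
    isDisjointiveDRL : IsDisjointiveDRL _≈_ _∧_ _∨_ ⊤ ⊥ ∼_ _·_ _\\_ _//_

  open IsDisjointiveDRL isDisjointiveDRL public

data Term : Set where
  var                             : ℕ → Term
  _∧ᵗ_ _∨ᵗ_ _·ᵗ_ _\\ᵗ_ _//ᵗ_      : Term → Term → Term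
  ⊤ᵗ ⊥ᵗ                           : Term
  ∼ᵗ_                             : Term → Term

module _ {c ℓ} (𝐀 : DisjointiveDRL c ℓ) where
  open DisjointiveDRL 𝐀

  ⟦_⟧ : Term → (ℕ → Carrier) → Carrier
  ⟦ var n  ⟧ v = v n
  ⟦ s ∧ᵗ t ⟧ v = ⟦ s ⟧ v ∧ ⟦ t ⟧ v
  ⟦ s ∨ᵗ t ⟧ v = ⟦ s ⟧ v ∨ ⟦ t ⟧ v
  ⟦ s ·ᵗ t ⟧ v = ⟦ s ⟧ v · ⟦ t ⟧ v
  ⟦ s \\ᵗ t ⟧ v = ⟦ s ⟧ v \\ ⟦ t ⟧ v
  ⟦ s //ᵗ t ⟧ v = ⟦ s ⟧ v // ⟦ t ⟧ v
  ⟦ ⊤ᵗ     ⟧ v = ⊤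
  ⟦ ⊥ᵗ     ⟧ v = ⊥
  ⟦ ∼ᵗ s   ⟧ v = ∼ ⟦ s ⟧ v

Equation : Set
Equation = Term × Term

EquationalTheory : (c ℓ : Level) → Equation → Set (lsuc (c ⊔ ℓ))
EquationalTheory c ℓ (σ , ρ) =
  (𝐀 : DisjointiveDRL c ℓ) → let open DisjointiveDRL 𝐀 in
  (v : ℕ → Carrier) → ⟦_⟧ 𝐀 σ v ≈ ⟦_⟧ 𝐀 ρ v

-- Equations as words: terms in Polish notation, the variable var n being
-- written as ‵x followed by n strokes.

data Letter : Set where
  ‵x ‵stroke ‵∧ ‵∨ ‵⊤ ‵⊥ ‵∼ ‵· ‵\\ ‵// ‵= : Letter

encodeTerm : Term → List Letter
encodeTerm (var n)  = ‵x ∷ replicate n ‵stroke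
encodeTerm (s ∧ᵗ t) = ‵∧ ∷ encodeTerm s ++ encodeTerm t
encodeTerm (s ∨ᵗ t) = ‵∨ ∷ encodeTerm s ++ encodeTerm t
encodeTerm (s ·ᵗ t) = ‵· ∷ encodeTerm s ++ encodeTerm t
encodeTerm (s \\ᵗ t) = ‵\\ ∷ encodeTerm s ++ encodeTerm t
encodeTerm (s //ᵗ t) = ‵// ∷ encodeTerm s ++ encodeTerm t
encodeTerm ⊤ᵗ       = ‵⊤ ∷ []
encodeTerm ⊥ᵗ       = ‵⊥ ∷ []
encodeTerm (∼ᵗ s)   = ‵∼ ∷ encodeTerm s

encode : Equation → List Letter
encode (σ , ρ) = encodeTerm σ ++ ‵= ∷ encodeTerm ρ

-- Deterministic machines with one two-way infinite tape. The tape alphabet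
-- consists of a blank (nothing), the input alphabet Letter, and finitely
-- many auxiliary symbols, so δ is a finite table.

data Direction : Set where
  left right : Direction

data Action (Q Γ : Set) : Set where
  halt : (accept : Bool) → Action Q Γ
  go   : (next : Q) (write : Γ) (move : Direction) → Action Q Γ

Symbol : ℕ → Set
Symbol auxiliary = Maybe (Letter ⊎ Fin auxiliary)

record TuringMachine : Set where
  field
    states auxiliary : ℕ
    start            : Fin states
    δ                : Fin states → Symbol auxiliary →
                       Action (Fin states) (Symbol auxiliary)

-- Both sides are listed outwards from the head; all cells not listed are
-- blank.
record Tape (auxiliary : ℕ) : Set where
  constructor tape
  field
    leftOfHead  : List (Symbol auxiliary)
    atHead      : Symbol auxiliary
    rightOfHead : List (Symbol auxiliary)

shift : ∀ {k} → Direction → Tape k → Tape k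
shift left  (tape []       a rs)       = tape []       nothing (a ∷ rs)
shift left  (tape (l ∷ ls) a rs)       = tape ls       l       (a ∷ rs)
shift right (tape ls       a [])       = tape (a ∷ ls) nothing []
shift right (tape ls       a (r ∷ rs)) = tape (a ∷ ls) r       rs

initialTape : ∀ {k} → List Letter → Tape k
initialTape []      = tape [] nothing []
initialTape (a ∷ w) = tape [] (just (inj₁ a)) (map (λ b → just (inj₁ b)) w)

module _ (M : TuringMachine) where
  open TuringMachine M

  data HaltsFrom : Fin states → Tape auxiliary → Bool → Set where
    now   : ∀ {q ls a rs b} → δ q a ≡ halt b → HaltsFrom q (tape ls a rs) b
    later : ∀ {q ls a rs b q′ a′ d} → δ q a ≡ go q′ a′ d →
            HaltsFrom q′ (shift d (tape ls a′ rs)) b →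
            HaltsFrom q (tape ls a rs) b

  Accepts Rejects : List Letter → Set
  Accepts w = HaltsFrom start (initialTape w) true
  Rejects w = HaltsFrom start (initialTape w) false

-- Only the behaviour on words that encode an instance is constrained.
Decides : ∀ {i p} {I : Set i} →
          TuringMachine → (I → List Letter) → (I → Set p) → Set (i ⊔ p)
Decides M code P =
  ∀ i → (P i → Accepts M (code i)) × (¬ P i → Rejects M (code i))

TuringDecidable : ∀ {i p} {I : Set i} →
                  (I → List Letter) → (I → Set p) → Set (i ⊔ p)
TuringDecidable code P = ∃[ M ] Decides M code P

{-# OPTIONS --safe #-}

-- Let d be a conjunction of terms c ∨ ∼ p, and D = □ d the largest ideal
-- element below d. Every multiple w = l · q · r of an element q ≤ D lies
-- below d, and w ≤ p then gives w ≤ p ∧ (c ∨ ∼ p) = p ∧ c ≤ c. With p and c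
-- of the form a \\ s, s // a or s, where a is a stack letter and s a state,
-- such steps push and pop letters at the two ends of w, so that the facts
-- w ≤ s trace the computation of a machine with two stacks l and r.
-- Conversely, any family of facts closed under these steps gives an algebra
-- of sets of configurations in which nothing else holds.
--
-- If M decided the equational theory, consider the equation stating that the
-- two-stack machine, started on a text u, reaches a rejecting state of M run
-- on the code of this very equation. This is no circle: u occurs in the code
-- of the equation only as a list of stack letters, the remaining text does
-- not depend on u, and u is chosen to be that text. M can then neither
-- accept nor reject the equation.

module Submission where

open import Defs
open import Algebra.Lattice.Bundles using (Lattice; RawLattice)
open import Algebra.Lattice.Morphism.Structures using (IsLatticeMonomorphism)
open import Algebra.Lattice.Structures using (IsDistributiveLattice)
open import Algebra.Bundles using (RawMagma)
open import Algebra.Morphism.Structures using (IsMagmaMonomorphism)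
open import Algebra.Structures using (IsSemigroup)
open import Data.Bool.Base using (true; false)
open import Data.Empty using () renaming (⊥ to Empty)
open import Data.Fin.Base using (Fin; toℕ)
open import Data.Fin.Properties using (toℕ-injective)
open import Data.List.Base
  using (List; []; _∷_; _++_; [_]; map; foldr; concat; concatMap; allFin; reverse; _ʳ++_;
         cartesianProductWith)
open import Data.List.Membership.Propositional using (_∈_)
open import Data.List.Membership.Propositional.Properties
  using (∈-map⁺; ∈-allFin; ∈-cartesianProductWith⁺)
open import Data.List.Properties
  using (++-assoc; ++-ʳ++; ʳ++-defn; map-++; reverse-map; reverse-involutive; ∷-injectiveˡ; ∷-injectiveʳ)
open import Data.List.Relation.Unary.All using (All; []; _∷_)
open import Data.List.Relation.Unary.Any using (Any; here; there)
open import Data.List.Relation.Unary.Any.Properties using (concat⁺)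
import Data.List.Relation.Unary.Any as Any
open import Data.Maybe.Base using (just; nothing)
open import Data.Nat.Base using (ℕ)
open import Data.Product.Base using (_×_; _,_; ∃-syntax; proj₁; proj₂)
open import Data.Sum.Base using (_⊎_; inj₁; inj₂)
open import Data.Unit.Base using (tt) renaming (⊤ to Unit)
open import Function.Base using (_∘_; id)
open import Function.Bundles using (_⇔_; mk⇔; Equivalence)
open import Level using (Level; Lift; lift; lower; 0ℓ) renaming (suc to lsuc)
open import Relation.Binary.Lattice using () renaming (DistributiveLattice to OrderDistributiveLattice)
open import Relation.Binary.PropositionalEquality
  using (_≡_; refl; sym; trans; cong; cong₂; subst; subst₂; module ≡-Reasoning)
import Relation.Binary.PropositionalEquality.Properties as ≡
open import Relation.Nullary using (¬_)
import Algebra.Lattice.Morphism.LatticeMonomorphism as LatticeMonomorphism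
import Algebra.Lattice.Properties.Lattice as LatticeProperties
import Algebra.Morphism.MagmaMonomorphism as MagmaMonomorphism
import Data.List.Membership.Setoid.Properties as Membership
import Relation.Binary.Lattice.Properties.DistributiveLattice as OrderDistributive
import Relation.Binary.Lattice.Properties.Lattice as OrderLattice

-- Finite sets and a numbering of their elements

record Finite (A : Set) : Set where
  field
    elements : List A
    complete : ∀ a → a ∈ elements

  index : A → ℕ
  index a = toℕ (Any.index (complete a))

  index-injective : ∀ {a b} → index a ≡ index b → a ≡ b
  index-injective {a} {b} eq =
    Membership.index-injective (≡.setoid A) (complete a) (complete b) (toℕ-injective eq)

open Finite using (elements; complete; index; index-injective)

-- Clauses about configurations

record Literal (L S : Set) : Set where
  constructor _⟫_⟪_
  field
    pushˡ : List L
    state : S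
    pushʳ : List L

infix 4 _⊢_

record Clause (L S : Set) : Set where
  constructor _⊢_
  field
    premises   : List (Literal L S)
    conclusion : Literal L S

Family : (L S : Set) (ℓ : Level) → Set (lsuc ℓ)
Family L S ℓ = S → List L → List L → Set ℓ

-- Both stacks are listed from the top. The left pushes are performed from
-- first to last, the right ones from last to first.
Holds : ∀ {L S ℓ} → Family L S ℓ → List L → List L → Literal L S → Set ℓ
Holds I l r (u ⟫ s ⟪ v) = I s (u ʳ++ l) (v ++ r)

-- The stacks `l` and `r` below the pushes are arbitrary and shared by premises and conclusion, so a
-- letter pushed only in a premise is popped by the clause.
Closed : ∀ {L S N : Set} {ℓ} → (N → Clause L S) → Family L S ℓ → Set ℓ
Closed clause I =
  ∀ n l r → All (Holds I l r) (Clause.premises (clause n)) →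
  Holds I l r (Clause.conclusion (clause n))

-- Order and residuals in a disjointive distributive residuated lattice

module Order {c ℓ} (𝐀 : DisjointiveDRL c ℓ) where
  open DisjointiveDRL 𝐀 hiding (_≤_)
  open IsDistributiveLattice isDistributiveLattice public
    using (isLattice; ∧-distribˡ-∨; ∨-congˡ)
    renaming (refl to ≈-refl; sym to ≈-sym; trans to ≈-trans)
  open IsSemigroup ·-isSemigroup public
    using () renaming (assoc to ·-assoc; ∙-congˡ to ·-congˡ)

  infix 3 _≤_

  _≤_ : Carrier → Carrier → Set ℓ
  x ≤ y = x ∧ y ≈ x

  private
    lattice : Lattice c ℓ
    lattice = record { isLattice = isLattice }

    module L where
      open LatticeProperties lattice public using (∨-∧-isOrderTheoreticLattice)
      open import Relation.Binary.Lattice.Structures using (IsLattice)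
      open IsLattice ∨-∧-isOrderTheoreticLattice public

  ≤-reflexive : ∀ {x y} → x ≈ y → x ≤ y
  -- The order-theoretic lattice `L` has the reversed equation `x ≈ x ∧ y` as its order, hence
  -- `≈-sym` throughout.
  ≤-reflexive p = ≈-sym (L.reflexive p)

  ≤-refl : ∀ {x} → x ≤ x
  ≤-refl = ≤-reflexive ≈-refl

  ≤-trans : ∀ {x y z} → x ≤ y → y ≤ z → x ≤ z
  ≤-trans p q = ≈-sym (L.trans (≈-sym p) (≈-sym q))

  ≤-antisym : ∀ {x y} → x ≤ y → y ≤ x → x ≈ y
  ≤-antisym p q = L.antisym (≈-sym p) (≈-sym q)

  x∧y≤x : ∀ x y → x ∧ y ≤ x
  x∧y≤x x y = ≈-sym (L.x∧y≤x x y)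

  x∧y≤y : ∀ x y → x ∧ y ≤ y
  x∧y≤y x y = ≈-sym (L.x∧y≤y x y)

  ∧-greatest : ∀ {x y z} → x ≤ y → x ≤ z → x ≤ y ∧ z
  ∧-greatest p q = ≈-sym (L.∧-greatest (≈-sym p) (≈-sym q))

  ≤-⊤ : ∀ x → x ≤ ⊤
  ≤-⊤ = proj₂ ∧-identity

  ⊥-≤ : ∀ x → ⊥ ≤ x
  ⊥-≤ x = ≤-trans (≈-sym (L.x≤x∨y ⊥ x)) (≤-reflexive (proj₁ ∨-identity x))

  \\-intro : ∀ {x y z} → x · y ≤ z → y ≤ x \\ z
  \\-intro = Equivalence.to (\\-residual _ _ _)

  \\-elim : ∀ {x y z} → y ≤ x \\ z → x · y ≤ z
  \\-elim = Equivalence.from (\\-residual _ _ _)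

  //-intro : ∀ {x y z} → x · y ≤ z → x ≤ z // y
  //-intro = Equivalence.to (//-residual _ _ _)

  //-elim : ∀ {x y z} → x ≤ z // y → x · y ≤ z
  //-elim = Equivalence.from (//-residual _ _ _)

  ·-monoʳ : ∀ x {y z} → y ≤ z → x · y ≤ x · z
  ·-monoʳ x p = \\-elim (≤-trans p (\\-intro ≤-refl))

  ·-monoˡ : ∀ x {y z} → y ≤ z → y · x ≤ z · x
  ·-monoˡ x p = //-elim (≤-trans p (//-intro ≤-refl))

  -- This is how a clause fires: distributivity and disjointness reduce `p ∧ (c ∨ ∼ p)` to `p ∧ c`.
  modus-ponens : ∀ {w p c} → w ≤ p → w ≤ c ∨ ∼ p → w ≤ c
  modus-ponens {w} {p} {c} w≤p w≤c∨∼p =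
    ≤-trans (∧-greatest w≤p w≤c∨∼p)
      (≤-trans (≤-reflexive eq) (x∧y≤y p c))
    where
    eq : p ∧ (c ∨ ∼ p) ≈ p ∧ c
    eq = ≈-trans (∧-distribˡ-∨ p c (∼ p))
           (≈-trans (∨-congˡ (∼-disjoint p)) (proj₂ ∨-identity (p ∧ c)))

  noncontradiction : ∀ {w x} → w ≤ x → w ≤ ∼ x → w ≈ ⊥
  noncontradiction {w} {x} p q =
    ≤-antisym (≤-trans (∧-greatest p q) (≤-reflexive (∼-disjoint x))) (⊥-≤ w)

  -- The inner meet secures `d` and its left multiples, the outer one adds right multiples. Since
  -- `·` may lack a unit, being below `d` has to be demanded separately from the multiples.
  □ : Carrier → Carrier
  □ d = (d ∧ ⊤ \\ d) ∧ (d ∧ ⊤ \\ d) // ⊤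

  module _ (d : Carrier) where
    private
      □ˡ : Carrier
      □ˡ = d ∧ ⊤ \\ d

    □≤ : □ d ≤ d
    □≤ = ≤-trans (x∧y≤x □ˡ _) (x∧y≤x d _)

    private
      ·-□ˡ : ∀ x → x · □ˡ ≤ □ˡ
      ·-□ˡ x = ∧-greatest (below x)
        (\\-intro (≤-trans (≤-reflexive (≈-sym (·-assoc ⊤ x □ˡ))) (below (⊤ · x))))
        where
        below : ∀ y → y · □ˡ ≤ d
        below y = ≤-trans (·-monoˡ □ˡ (≤-⊤ y)) (\\-elim (x∧y≤y d _))

      □·-≤ : ∀ y → □ d · y ≤ □ˡ
      □·-≤ y = ≤-trans (·-monoʳ (□ d) (≤-⊤ y)) (//-elim (x∧y≤y □ˡ _))

    -- The condition on right multiples survives a left factor: by associativity `⊤` is absorbed on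
    -- the right first, and `x` on the left afterwards.
    ·-□ : ∀ x → x · □ d ≤ □ d
    ·-□ x = ∧-greatest
      (≤-trans (·-monoʳ x (x∧y≤x □ˡ _)) (·-□ˡ x))
      (//-intro (≤-trans (≤-reflexive (·-assoc x (□ d) ⊤))
        (≤-trans (·-monoʳ x (□·-≤ ⊤)) (·-□ˡ x))))

    □-· : ∀ y → □ d · y ≤ □ d
    □-· y = ∧-greatest (□·-≤ y)
      (//-intro (≤-trans (≤-reflexive (·-assoc (□ d) y ⊤)) (□·-≤ (y · ⊤))))

-- The complex algebra of an associative ternary relation

-- Inclusions hold up to double negation, which makes the algebra Boolean
-- without excluded middle.
module Complex {X : Set} (_∙_↦_ : X → X → X → Set)
  (assocʳ : ∀ {x y z xy w} → x ∙ y ↦ xy → xy ∙ z ↦ w → ∃[ yz ] y ∙ z ↦ yz × x ∙ yz ↦ w)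
  (assocˡ : ∀ {x y z yz w} → y ∙ z ↦ yz → x ∙ yz ↦ w → ∃[ xy ] x ∙ y ↦ xy × xy ∙ z ↦ w)
  where

  private
    Pred : Set₁
    Pred = X → Set

    infix 3 _⊆_ _≐_

    _⊆_ _≐_ : Pred → Pred → Set
    P ⊆ Q = ∀ x → P x → ¬ ¬ Q x
    P ≐ Q = (P ⊆ Q) × (Q ⊆ P)

    -- With the double negation in `_∪_`, a term `c ∨ ∼ p` holds outright at every point where `p`
    -- entails `c`.
    _∩_ _∪_ _•_ _⇘_ _⇙_ : Pred → Pred → Pred
    (P ∩ Q) x = P x × Q x
    (P ∪ Q) x = ¬ ¬ (P x ⊎ Q x)
    (P • Q) x = ∃[ y ] ∃[ z ] P y × Q z × y ∙ z ↦ x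
    (P ⇘ Q) x = ∀ y z → P y → y ∙ x ↦ z → ¬ ¬ Q z
    (Q ⇙ P) x = ∀ y z → P y → x ∙ y ↦ z → ¬ ¬ Q z

    ∁ : Pred → Pred
    ∁ P x = ¬ P x

    ⊆-refl : ∀ {P} → P ⊆ P
    ⊆-refl x p k = k p

    ⊆-trans : ∀ {P Q R} → P ⊆ Q → Q ⊆ R → P ⊆ R
    ⊆-trans f g x p k = f x p λ q → g x q k

    order : OrderDistributiveLattice (lsuc 0ℓ) 0ℓ 0ℓ
    order = record
      { Carrier = Pred
      ; _≈_ = _≐_
      ; _≤_ = _⊆_
      ; _∨_ = _∪_
      ; _∧_ = _∩_
      ; isDistributiveLattice = record
        { isLattice = record
          { isPartialOrder = record
            { isPreorder = record
              { isEquivalence = record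
                { refl = ⊆-refl , ⊆-refl
                ; sym = λ (f , g) → g , f
                ; trans = λ (f , g) (h , k) → ⊆-trans f h , ⊆-trans k g
                }
              ; reflexive = proj₁
              ; trans = ⊆-trans
              }
            ; antisym = _,_
            }
          ; supremum = λ P Q →
              (λ x p k → k λ n → n (inj₁ p)) ,
              (λ x q k → k λ n → n (inj₂ q)) ,
              λ R f g x n k → n λ { (inj₁ p) → f x p k ; (inj₂ q) → g x q k }
          ; infimum = λ P Q →
              (λ x (p , q) k → k p) ,
              (λ x (p , q) k → k q) ,
              λ R f g x r k → f x r λ p → g x r λ q → k (p , q)
          }
        ; ∧-distribˡ-∨ = λ P Q R →
            (λ x (p , n) k → n λ
              { (inj₁ q) → k λ m → m (inj₁ (p , q))
              ; (inj₂ r) → k λ m → m (inj₂ (p , r)) }) ,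
            (λ x n k → n λ
              { (inj₁ (p , q)) → k (p , λ m → m (inj₁ q))
              ; (inj₂ (p , r)) → k (p , λ m → m (inj₂ r)) })
        }
      }

    module O = OrderDistributiveLattice order

    ≤⇒⊆ : ∀ {P Q} → (P ∩ Q) ≐ P → P ⊆ Q
    ≤⇒⊆ (_ , g) x p k = g x p λ (_ , q) → k q

    ⊆⇒≤ : ∀ {P Q} → P ⊆ Q → (P ∩ Q) ≐ P
    ⊆⇒≤ f = (λ x (p , q) k → k p) , λ x p k → f x p λ q → k (p , q)

    •-mono : ∀ {P P′ Q Q′} → P ⊆ P′ → Q ⊆ Q′ → (P • Q) ⊆ (P′ • Q′)
    •-mono f g x (y , z , p , q , m) k =
      f y p λ p′ → g z q λ q′ → k (y , z , p′ , q′ , m)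

    ⇘-mono : ∀ {P P′ Q Q′} → P′ ⊆ P → Q ⊆ Q′ → (P ⇘ Q) ⊆ (P′ ⇘ Q′)
    ⇘-mono f g x h k = k λ y z p m n → f y p λ p′ → h y z p′ m λ q → g z q n

    ⇙-mono : ∀ {P P′ Q Q′} → P′ ⊆ P → Q ⊆ Q′ → (Q ⇙ P) ⊆ (Q′ ⇙ P′)
    ⇙-mono f g x h k = k λ y z p m n → f y p λ p′ → h y z p′ m λ q → g z q n

  complexAlgebra : DisjointiveDRL (lsuc 0ℓ) 0ℓ
  complexAlgebra = record
    { Carrier = Pred
    ; _≈_ = _≐_
    ; _∧_ = _∩_
    ; _∨_ = _∪_
    ; ⊤ = λ _ → Unit
    ; ⊥ = λ _ → Empty
    ; ∼_ = ∁
    ; _·_ = _•_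
    ; _\\_ = _⇘_
    ; _//_ = _⇙_
    ; isDisjointiveDRL = record
      { isDistributiveLattice = record
        { isLattice = OrderLattice.isAlgLattice O.lattice
        ; ∨-distrib-∧ = OrderDistributive.∨-distrib-∧ order
        ; ∧-distrib-∨ = OrderDistributive.∧-distrib-∨ order
        }
      ; ∧-identity =
          (λ P → (λ x (_ , p) k → k p) , λ x p k → k (tt , p)) ,
          (λ P → (λ x (p , _) k → k p) , λ x p k → k (p , tt))
      ; ∨-identity =
          (λ P → (λ x n k → n λ { (inj₂ p) → k p }) , λ x p k → k λ m → m (inj₂ p)) ,
          (λ P → (λ x n k → n λ { (inj₁ p) → k p }) , λ x p k → k λ m → m (inj₁ p))
      ; ·-isSemigroup = record
        { isMagma = record
          { isEquivalence = O.isEquivalence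
          ; ∙-cong = λ (f , f′) (g , g′) → •-mono f g , •-mono f′ g′
          }
        ; assoc = λ P Q R →
            (λ { x (u , z , (a , b , p , q , m) , r , n) k →
                 let v , m′ , n′ = assocʳ m n in k (a , v , p , (b , z , q , r , m′) , n′) }) ,
            (λ { x (a , v , p , (b , z , q , r , m) , n) k →
                 let u , m′ , n′ = assocˡ m n in k (u , z , (a , b , p , q , m′) , r , n′) })
        }
      ; \\-cong = λ (f , f′) (g , g′) → ⇘-mono f′ g , ⇘-mono f g′
      ; //-cong = λ (g , g′) (f , f′) → ⇙-mono f′ g , ⇙-mono f g′
      ; \\-residual = λ P Q R → mk⇔
          (λ h → ⊆⇒≤ λ z q k → k λ y x p m → ≤⇒⊆ h x (y , z , p , q , m))
          (λ h → ⊆⇒≤ λ { x (y , z , p , q , m) k → ≤⇒⊆ h z q λ f → f y x p m k })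
      ; //-residual = λ P Q R → mk⇔
          (λ h → ⊆⇒≤ λ y p k → k λ z x q m → ≤⇒⊆ h x (y , z , p , q , m))
          (λ h → ⊆⇒≤ λ { x (y , z , p , q , m) k → ≤⇒⊆ h y p λ f → f z x q m k })
      ; ∼-cong = λ (f , g) →
          (λ x n k → k λ q → g x q n) , (λ x n k → k λ p → f x p n)
      ; ∼-disjoint = λ P → (λ x (p , n) k → n p) , λ x ()
      }
    }

-- Terms, identified when 𝐁 does, form an algebra at any universe levels

module Syntactic {b} (𝐁 : DisjointiveDRL b 0ℓ) (v : ℕ → DisjointiveDRL.Carrier 𝐁) (c ℓ : Level) where
  private
    module B = DisjointiveDRL 𝐁
    module BL = IsDistributiveLattice B.isDistributiveLattice

    T : Set c
    T = Lift c Term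

    val : T → B.Carrier
    val t = ⟦ 𝐁 ⟧ (lower t) v

    _≈_ : T → T → Set ℓ
    s ≈ t = Lift ℓ (val s B.≈ val t)

    rawLattice : RawLattice c ℓ
    rawLattice = record
      { Carrier = T
      ; _≈_ = _≈_
      ; _∧_ = λ s t → lift (lower s ∧ᵗ lower t)
      ; _∨_ = λ s t → lift (lower s ∨ᵗ lower t)
      }

    rawLatticeᴮ : RawLattice b 0ℓ
    rawLatticeᴮ = record { Carrier = B.Carrier ; _≈_ = B._≈_ ; _∧_ = B._∧_ ; _∨_ = B._∨_ }

    -- Equality of terms is defined through `val`, which is thus injective by construction, and the
    -- laws pull back along it.
    latticeMono : IsLatticeMonomorphism rawLattice rawLatticeᴮ val
    latticeMono = record
      { isLatticeHomomorphism = record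
        { isRelHomomorphism = record { cong = lower }
        ; ∧-homo = λ _ _ → BL.refl
        ; ∨-homo = λ _ _ → BL.refl
        }
      ; injective = lift
      }

    rawMagma : RawMagma c ℓ
    rawMagma = record { Carrier = T ; _≈_ = _≈_ ; _∙_ = λ s t → lift (lower s ·ᵗ lower t) }

    rawMagmaᴮ : RawMagma b 0ℓ
    rawMagmaᴮ = record { Carrier = B.Carrier ; _≈_ = B._≈_ ; _∙_ = B._·_ }

    magmaMono : IsMagmaMonomorphism rawMagma rawMagmaᴮ val
    magmaMono = record
      { isMagmaHomomorphism = record
        { isRelHomomorphism = record { cong = lower }
        ; homo = λ _ _ → BL.refl
        }
      ; injective = lift
      }

    lift⇔ : ∀ {A A′ : Set} → A ⇔ A′ → Lift ℓ A ⇔ Lift ℓ A′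
    lift⇔ e = mk⇔ (λ (lift a) → lift (Equivalence.to e a)) (λ (lift a) → lift (Equivalence.from e a))

    termAlgebra : DisjointiveDRL c ℓ
    termAlgebra = record
      { Carrier = T
      ; _≈_ = _≈_
      ; _∧_ = λ s t → lift (lower s ∧ᵗ lower t)
      ; _∨_ = λ s t → lift (lower s ∨ᵗ lower t)
      ; ⊤ = lift ⊤ᵗ
      ; ⊥ = lift ⊥ᵗ
      ; ∼_ = λ s → lift (∼ᵗ lower s)
      ; _·_ = λ s t → lift (lower s ·ᵗ lower t)
      ; _\\_ = λ s t → lift (lower s \\ᵗ lower t)
      ; _//_ = λ s t → lift (lower s //ᵗ lower t)
      ; isDisjointiveDRL = record
        { isDistributiveLattice =
            LatticeMonomorphism.isDistributiveLattice latticeMono B.isDistributiveLattice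
        ; ∧-identity = (λ _ → lift (proj₁ B.∧-identity _)) , (λ _ → lift (proj₂ B.∧-identity _))
        ; ∨-identity = (λ _ → lift (proj₁ B.∨-identity _)) , (λ _ → lift (proj₂ B.∨-identity _))
        ; ·-isSemigroup = MagmaMonomorphism.isSemigroup magmaMono B.·-isSemigroup
        ; \\-cong = λ (lift p) (lift q) → lift (B.\\-cong p q)
        ; //-cong = λ (lift p) (lift q) → lift (B.//-cong p q)
        ; \\-residual = λ _ _ _ → lift⇔ (B.\\-residual _ _ _)
        ; //-residual = λ _ _ _ → lift⇔ (B.//-residual _ _ _)
        ; ∼-cong = λ (lift p) → lift (B.∼-cong p)
        ; ∼-disjoint = λ _ → lift (B.∼-disjoint _)
        }
      }

    generic : ∀ t → lower (⟦ termAlgebra ⟧ t (λ n → lift (var n))) ≡ t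
    generic (var n)  = refl
    generic (s ∧ᵗ t) = cong₂ _∧ᵗ_ (generic s) (generic t)
    generic (s ∨ᵗ t) = cong₂ _∨ᵗ_ (generic s) (generic t)
    generic (s ·ᵗ t) = cong₂ _·ᵗ_ (generic s) (generic t)
    generic (s \\ᵗ t) = cong₂ _\\ᵗ_ (generic s) (generic t)
    generic (s //ᵗ t) = cong₂ _//ᵗ_ (generic s) (generic t)
    generic ⊤ᵗ       = refl
    generic ⊥ᵗ       = refl
    generic (∼ᵗ s)   = cong ∼ᵗ_ (generic s)

  -- The complex algebra lives at fixed levels, while validity is assumed at arbitrary `c` and `ℓ`.
  -- The term algebra exists at all levels, and evaluating its variables at themselves recovers the
  -- values in `𝐁`.
  transfer : ∀ e → EquationalTheory c ℓ e → ⟦ 𝐁 ⟧ (proj₁ e) v B.≈ ⟦ 𝐁 ⟧ (proj₂ e) v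
  transfer (σ , ρ) valid =
    subst₂ (λ s t → ⟦ 𝐁 ⟧ s v B.≈ ⟦ 𝐁 ⟧ t v) (generic σ) (generic ρ)
      (lower (valid termAlgebra (λ n → lift (var n))))

-- The equation of a finite set of clauses

module Clauses {L S N : Set} (finiteL : Finite L) (finiteS : Finite S) (finiteN : Finite N)
  (clause : N → Clause L S) where

  -- Letters and states are numbered independently, so one variable may serve as both; `valuation`
  -- keeps the roles apart by the kind of point.
  letter : L → Term
  letter a = var (index finiteL a)

  resˡ : List L → Term → Term
  resˡ []      t = t
  resˡ (a ∷ u) t = letter a \\ᵗ resˡ u t

  -- The first letter is innermost, hence pushed last and on top. In `resˡ` it is outermost and
  -- pushed first.
  resʳ : List L → Term → Term
  resʳ []      t = t
  resʳ (b ∷ v) t = resʳ v (t //ᵗ letter b)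

  literal : Literal L S → Term
  literal (u ⟫ s ⟪ v) = resˡ u (resʳ v (var (index finiteS s)))

  ⋀ : List Term → Term
  ⋀ = foldr _∧ᵗ_ ⊤ᵗ

  clauseTerm : Clause L S → Term
  clauseTerm (ps ⊢ c) = literal c ∨ᵗ (∼ᵗ ⋀ (map literal ps))

  axioms : Term
  axioms = ⋀ (map (clauseTerm ∘ clause) (elements finiteN))

  -- In any algebra this is the largest two-sided ideal element below t.
  □ᵗ : Term → Term
  □ᵗ t = (t ∧ᵗ (⊤ᵗ \\ᵗ t)) ∧ᵗ ((t ∧ᵗ (⊤ᵗ \\ᵗ t)) //ᵗ ⊤ᵗ)

  background : S → Term
  background goal = □ᵗ axioms ∧ᵗ (∼ᵗ var (index finiteS goal))

  -- The left side plays the configuration with empty stacks: it satisfies the initial literal, its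
  -- multiples obey the clauses, and it is disjoint from the goal. That it is `⊥` expresses that the
  -- goal follows.
  equation : Literal L S → S → Equation
  equation init goal = literal init ∧ᵗ background goal , ⊥ᵗ

  -- Soundness: the facts that hold in an arbitrary algebra

  module Soundness {c ℓ} (𝐀 : DisjointiveDRL c ℓ) (v : ℕ → DisjointiveDRL.Carrier 𝐀)
    (init : Literal L S) (goal : S) where
    open DisjointiveDRL 𝐀 hiding (_≤_)
    open Order 𝐀

    private
      ev : Term → Carrier
      ev t = ⟦ 𝐀 ⟧ t v

      q : Carrier
      q = ev (proj₁ (equation init goal))

      -- Stacks act on elements, because a semigroup may have no element for the empty stack. The
      -- top letter becomes the outermost factor.
      actˡ actʳ : List L → Carrier → Carrier
      actˡ []      x = x
      actˡ (a ∷ l) x = ev (letter a) · actˡ l x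
      actʳ []      x = x
      actʳ (b ∷ r) x = actʳ r x · ev (letter b)

      conf : List L → List L → Carrier
      conf l r = actˡ l (actʳ r q)

      actˡ-· : ∀ l x y → actˡ l (x · y) ≈ actˡ l x · y
      actˡ-· []      x y = ≈-refl
      actˡ-· (a ∷ l) x y = ≈-trans (·-congˡ (actˡ-· l x y)) (≈-sym (·-assoc _ _ y))

      conf-∷ʳ : ∀ l b r → conf l (b ∷ r) ≈ conf l r · ev (letter b)
      conf-∷ʳ l b r = actˡ-· l (actʳ r q) (ev (letter b))

      -- The core `q` lies below the ideal element, which absorbs letters from both sides.
      conf≤□ : ∀ l r → conf l r ≤ □ (ev axioms)
      conf≤□ [] [] = ≤-trans (x∧y≤y _ _) (x∧y≤x _ _)
      conf≤□ [] (b ∷ r) = ≤-trans (·-monoˡ _ (conf≤□ [] r)) (□-· _ _)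
      conf≤□ (a ∷ l) r = ≤-trans (·-monoʳ _ (conf≤□ l r)) (·-□ _ _)

      ⋀-≤ : ∀ {t ts} → t ∈ ts → ev (⋀ ts) ≤ ev t
      ⋀-≤ (here refl) = x∧y≤x _ _
      ⋀-≤ (there m)   = ≤-trans (x∧y≤y _ _) (⋀-≤ m)

    Below : Family L S ℓ
    Below s l r = conf l r ≤ ev (var (index finiteS s))

    private
      resʳ-intro : ∀ u {t} l r → conf l (u ++ r) ≤ ev t → conf l r ≤ ev (resʳ u t)
      resʳ-intro []      l r p = p
      resʳ-intro (b ∷ u) l r p = resʳ-intro u l r
        (//-intro (≤-trans (≤-reflexive (≈-sym (conf-∷ʳ l b (u ++ r)))) p))

      resʳ-elim : ∀ u {t} l r → conf l r ≤ ev (resʳ u t) → conf l (u ++ r) ≤ ev t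
      resʳ-elim []      l r p = p
      resʳ-elim (b ∷ u) l r p =
        ≤-trans (≤-reflexive (conf-∷ʳ l b (u ++ r))) (//-elim (resʳ-elim u l r p))

      resˡ-intro : ∀ u {t} l r → conf (u ʳ++ l) r ≤ ev t → conf l r ≤ ev (resˡ u t)
      resˡ-intro []      l r p = p
      resˡ-intro (a ∷ u) l r p = \\-intro (resˡ-intro u (a ∷ l) r p)

      resˡ-elim : ∀ u {t} l r → conf l r ≤ ev (resˡ u t) → conf (u ʳ++ l) r ≤ ev t
      resˡ-elim []      l r p = p
      resˡ-elim (a ∷ u) l r p = resˡ-elim u (a ∷ l) r (\\-elim p)

      literal-intro : ∀ lit l r → Holds Below l r lit → conf l r ≤ ev (literal lit)
      literal-intro (u ⟫ s ⟪ w) l r p = resˡ-intro u l r (resʳ-intro w (u ʳ++ l) r p)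

      literal-elim : ∀ lit l r → conf l r ≤ ev (literal lit) → Holds Below l r lit
      literal-elim (u ⟫ s ⟪ w) l r p = resʳ-elim w (u ʳ++ l) r (resˡ-elim u l r p)

      premises-intro : ∀ ps l r → All (Holds Below l r) ps → conf l r ≤ ev (⋀ (map literal ps))
      premises-intro []       l r []       = ≤-⊤ _
      premises-intro (p ∷ ps) l r (h ∷ hs) =
        ∧-greatest (literal-intro p l r h) (premises-intro ps l r hs)

    Below-closed : Closed clause Below
    Below-closed n l r hs = literal-elim (Clause.conclusion (clause n)) l r
      (modus-ponens (premises-intro _ l r hs)
        (≤-trans (≤-trans (conf≤□ l r) (□≤ _))
          (⋀-≤ (∈-map⁺ (clauseTerm ∘ clause) (complete finiteN n)))))

    Below-init : Holds Below [] [] init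
    Below-init = literal-elim init [] [] (x∧y≤x _ _)

    Below-goal : Below goal [] [] → q ≈ ⊥
    Below-goal p = noncontradiction p (≤-trans (x∧y≤y _ _) (x∧y≤y _ _))

  sound : ∀ {c ℓ} init goal →
    ((I : Family L S ℓ) → Closed clause I → Holds I [] [] init → I goal [] []) →
    EquationalTheory c ℓ (equation init goal)
  sound init goal entailed 𝐀 v =
    Below-goal (entailed Below Below-closed Below-init)
    where open Soundness 𝐀 v init goal

  -- Completeness: a countermodel of words and configurations

  data Point : Set where
    word : List L → Point
    conf : List L → List L → Point

  -- Words act on the left stack from the left and on the right stack from the right, where the last
  -- letter comes out on top and the word is reversed. Two configurations have no product.
  data _∙_↦_ : Point → Point → Point → Set where
    word-word : ∀ {u v}   → word u ∙ word v ↦ word (u ++ v)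
    word-conf : ∀ {u l r} → word u ∙ conf l r ↦ conf (u ++ l) r
    conf-word : ∀ {v l r} → conf l r ∙ word v ↦ conf l (v ʳ++ r)

  private
    cast : ∀ {x y z z′} → z ≡ z′ → x ∙ y ↦ z → x ∙ y ↦ z′
    cast refl m = m

  assocʳ : ∀ {x y z xy w} → x ∙ y ↦ xy → xy ∙ z ↦ w → ∃[ yz ] y ∙ z ↦ yz × x ∙ yz ↦ w
  assocʳ (word-word {u} {v}) (word-word {v = w}) =
    _ , word-word , cast (cong word (sym (++-assoc u v w))) word-word
  assocʳ (word-word {u} {v}) (word-conf {l = l} {r}) =
    _ , word-conf , cast (cong (λ k → conf k r) (sym (++-assoc u v l))) word-conf
  assocʳ word-conf conf-word = _ , conf-word , word-conf
  assocʳ (conf-word {u} {l}) (conf-word {v}) =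
    _ , word-word , cast (cong (conf l) (++-ʳ++ u)) conf-word

  assocˡ : ∀ {x y z yz w} → y ∙ z ↦ yz → x ∙ yz ↦ w → ∃[ xy ] x ∙ y ↦ xy × xy ∙ z ↦ w
  assocˡ (word-word {v} {w}) (word-word {u}) =
    _ , word-word , cast (cong word (++-assoc u v w)) word-word
  assocˡ (word-word {u} {v}) (conf-word {l = l}) =
    _ , conf-word , cast (cong (conf l) (sym (++-ʳ++ u))) conf-word
  assocˡ (word-conf {v} {l} {r}) (word-conf {u}) =
    _ , word-word , cast (cong (λ k → conf k r) (++-assoc u v l)) word-conf
  assocˡ conf-word word-conf = _ , word-conf , conf-word

  module Completeness (I : Family L S 0ℓ) (I-closed : Closed clause I) where
    open Complex _∙_↦_ assocʳ assocˡ using (complexAlgebra)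

    valuation : ℕ → Point → Set
    valuation n (word w)   = ∃[ a ] index finiteL a ≡ n × w ≡ [ a ]
    valuation n (conf l r) = ∃[ s ] index finiteS s ≡ n × I s l r

    private
      ev : Term → Point → Set
      ev t = ⟦ complexAlgebra ⟧ t valuation

      state-elim : ∀ s l r → ev (var (index finiteS s)) (conf l r) → I s l r
      state-elim s l r (s′ , eq , h) with refl ← index-injective finiteS eq = h

      resʳ-intro : ∀ u t l r → ev t (conf l (u ++ r)) → ev (resʳ u t) (conf l r)
      resʳ-intro []      t l r h = h
      resʳ-intro (b ∷ u) t l r h = resʳ-intro u _ l r below
        where
        below : ev (t //ᵗ letter b) (conf l (u ++ r))
        below (word w) _ (a , eq , refl) conf-word k with refl ← index-injective finiteL eq = k h

      -- Residuals conclude under a double negation, and elimination inherits it.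
      resʳ-elim : ∀ u t l r → ev (resʳ u t) (conf l r) → ¬ ¬ ev t (conf l (u ++ r))
      resʳ-elim []      t l r h k = k h
      resʳ-elim (b ∷ u) t l r h k =
        resʳ-elim u _ l r h λ h′ → h′ (word [ b ]) _ (b , refl , refl) conf-word k

      resˡ-intro : ∀ u t l r → ev t (conf (u ʳ++ l) r) → ev (resˡ u t) (conf l r)
      resˡ-intro []      t l r h = h
      resˡ-intro (a ∷ u) t l r h (word w) _ (b , eq , refl) word-conf k
        with refl ← index-injective finiteL eq = k (resˡ-intro u t (a ∷ l) r h)

      resˡ-elim : ∀ u t l r → ev (resˡ u t) (conf l r) → ¬ ¬ ev t (conf (u ʳ++ l) r)
      resˡ-elim []      t l r h k = k h
      resˡ-elim (a ∷ u) t l r h k =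
        h (word [ a ]) _ (a , refl , refl) word-conf λ h′ → resˡ-elim u t (a ∷ l) r h′ k

      literal-intro : ∀ lit l r → Holds I l r lit → ev (literal lit) (conf l r)
      literal-intro (u ⟫ s ⟪ w) l r h =
        resˡ-intro u _ l r (resʳ-intro w _ (u ʳ++ l) r (s , refl , h))

      literal-elim : ∀ lit l r → ev (literal lit) (conf l r) → ¬ ¬ Holds I l r lit
      literal-elim (u ⟫ s ⟪ w) l r h k =
        resˡ-elim u _ l r h λ h′ → resʳ-elim w _ (u ʳ++ l) r h′ λ h″ → k (state-elim s _ _ h″)

      premises-elim : ∀ ps l r → ev (⋀ (map literal ps)) (conf l r) → ¬ ¬ All (Holds I l r) ps
      premises-elim []       l r _        k = k []
      premises-elim (p ∷ ps) l r (h , hs) k =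
        literal-elim p l r h λ h′ → premises-elim ps l r hs λ hs′ → k (h′ ∷ hs′)

      -- Classical reasoning inside the double negation: claim that the premises fail, and answer a
      -- proof of them by switching to the conclusion.
      clause-holds : ∀ n l r → ev (clauseTerm (clause n)) (conf l r)
      clause-holds n l r k = k (inj₂ λ h → premises-elim _ l r h λ hs →
        k (inj₁ (literal-intro (Clause.conclusion (clause n)) l r (I-closed n l r hs))))

      axioms-hold : ∀ ns l r → ev (⋀ (map (clauseTerm ∘ clause) ns)) (conf l r)
      axioms-hold []       l r = tt
      axioms-hold (n ∷ ns) l r = clause-holds n l r , axioms-hold ns l r

      -- A product with a configuration as a factor is a configuration, so a term true at all
      -- configurations is true at all multiples of one.
      □-intro : ∀ t → (∀ l r → ev t (conf l r)) → ev (□ᵗ t) (conf [] [])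
      □-intro t h = □ˡ [] [] , λ { (word w) _ _ conf-word k → k (□ˡ [] _) }
        where
        □ˡ : ∀ l r → ev (t ∧ᵗ (⊤ᵗ \\ᵗ t)) (conf l r)
        □ˡ l r = h l r , λ { (word w) _ _ word-conf k → k (h _ r) }

    complete-for : ∀ c ℓ init goal → EquationalTheory c ℓ (equation init goal) →
      Holds I [] [] init → ¬ ¬ I goal [] []
    complete-for c ℓ init goal valid h ¬goal =
      -- Validity includes the left side in the empty predicate, up to double negation; without the
      -- goal, `conf [] []` would belong to it.
      proj₁ (Syntactic.transfer complexAlgebra valuation c ℓ (equation init goal) valid) (conf [] [])
        ( literal-intro init [] [] h
        , □-intro axioms (axioms-hold (elements finiteN))
        , λ h′ → ¬goal (state-elim goal [] [] h′) )
        id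

-- Clauses simulating a Turing machine on its own equation

fromParts : ∀ {A : Set} (parts : List (List A)) → (∀ a → Any (a ∈_) parts) → Finite A
fromParts parts covered = record { elements = concat parts ; complete = concat⁺ ∘ covered }

pattern there₂ m = there (there m)
pattern there₄ m = there₂ (there₂ m)
pattern there₈ m = there₄ (there₄ m)

finiteFin : ∀ n → Finite (Fin n)
finiteFin n = record { elements = allFin n ; complete = ∈-allFin }

finiteLetter : Finite Letter
finiteLetter = record
  { elements = ‵x ∷ ‵stroke ∷ ‵∧ ∷ ‵∨ ∷ ‵⊤ ∷ ‵⊥ ∷ ‵∼ ∷ ‵· ∷ ‵\\ ∷ ‵// ∷ ‵= ∷ []
  ; complete = λ where
      ‵x      → here refl
      ‵stroke → there (here refl)
      ‵∧      → there₂ (here refl)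
      ‵∨      → there₂ (there (here refl))
      ‵⊤      → there₄ (here refl)
      ‵⊥      → there₄ (there (here refl))
      ‵∼      → there₄ (there₂ (here refl))
      ‵·      → there₄ (there₂ (there (here refl)))
      ‵\\     → there₈ (here refl)
      ‵//     → there₈ (there (here refl))
      ‵=      → there₈ (there₂ (here refl))
  }

finiteSymbol : ∀ k → Finite (Symbol k)
finiteSymbol k = fromParts
  ( [ nothing ]
  ∷ map (just ∘ inj₁) (elements finiteLetter)
  ∷ map (just ∘ inj₂) (elements (finiteFin k))
  ∷ [])
  λ where
    nothing         → here (here refl)
    (just (inj₁ a)) → there (here (∈-map⁺ (just ∘ inj₁) (complete finiteLetter a)))
    (just (inj₂ i)) → there₂ (here (∈-map⁺ (just ∘ inj₂) (complete (finiteFin k) i)))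

-- The two-stack machine

module Simulation (M : TuringMachine) where
  open TuringMachine M

  Γ : Set
  Γ = Symbol auxiliary

  -- The bottom marker # stands for an infinite supply of blanks; primed
  -- letters behave on the tape like the plain ones.
  data Cell : Set where
    #      : Cell
    plain  : Γ → Cell
    primed : Letter → Cell

  data State : Set where
    load copying padding guessing spelling spelled rejecting accepting : State
    at                    : Fin states → Γ → State
    fetchingˡ fetchingʳ   : Fin states → State

  data Rule : Set where
    load-copying load-guessing copy-end guess-end spell-end join : Rule
    copy pad guess spell : Letter → Rule
    step                 : Fin states → Γ → Rule
    fetchˡ fetchʳ        : Fin states → Cell → Rule
    popˡ popʳ            : Cell → Rule

  private
    Q : Finite (Fin states)
    Q = finiteFin states

    G : Finite Γ
    G = finiteSymbol auxiliary

  finiteCell : Finite Cell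
  finiteCell = fromParts
    ([ # ] ∷ map plain (elements G) ∷ map primed (elements finiteLetter) ∷ [])
    λ where
      #          → here (here refl)
      (plain a)  → there (here (∈-map⁺ plain (complete G a)))
      (primed b) → there₂ (here (∈-map⁺ primed (complete finiteLetter b)))

  finiteState : Finite State
  finiteState = fromParts
    ( (load ∷ copying ∷ padding ∷ guessing ∷ spelling ∷ spelled ∷ rejecting ∷ accepting ∷ [])
    ∷ cartesianProductWith at (elements Q) (elements G)
    ∷ map fetchingˡ (elements Q)
    ∷ map fetchingʳ (elements Q)
    ∷ [])
    λ where
      load          → here (here refl)
      copying       → here (there (here refl))
      padding       → here (there₂ (here refl))
      guessing      → here (there₂ (there (here refl)))
      spelling      → here (there₄ (here refl))
      spelled       → here (there₄ (there (here refl)))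
      rejecting     → here (there₄ (there₂ (here refl)))
      accepting     → here (there₄ (there₂ (there (here refl))))
      (at p a)      → there (here (∈-cartesianProductWith⁺ at (complete Q p) (complete G a)))
      (fetchingˡ p) → there₂ (here (∈-map⁺ fetchingˡ (complete Q p)))
      (fetchingʳ p) → there₂ (there (here (∈-map⁺ fetchingʳ (complete Q p))))

  finiteRule : Finite Rule
  finiteRule = fromParts
    ( (load-copying ∷ load-guessing ∷ copy-end ∷ guess-end ∷ spell-end ∷ join ∷ [])
    ∷ map copy (elements finiteLetter)
    ∷ map pad (elements finiteLetter)
    ∷ map guess (elements finiteLetter)
    ∷ map spell (elements finiteLetter)
    ∷ map popˡ (elements finiteCell)
    ∷ map popʳ (elements finiteCell)
    ∷ cartesianProductWith step (elements Q) (elements G)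
    ∷ cartesianProductWith fetchˡ (elements Q) (elements finiteCell)
    ∷ cartesianProductWith fetchʳ (elements Q) (elements finiteCell)
    ∷ [])
    λ where
      load-copying  → here (here refl)
      load-guessing → here (there (here refl))
      copy-end      → here (there₂ (here refl))
      guess-end     → here (there₂ (there (here refl)))
      spell-end     → here (there₄ (here refl))
      join          → here (there₄ (there (here refl)))
      (copy b)      → there (here (∈-map⁺ copy (complete finiteLetter b)))
      (pad b)       → there₂ (here (∈-map⁺ pad (complete finiteLetter b)))
      (guess b)     → there₂ (there (here (∈-map⁺ guess (complete finiteLetter b))))
      (spell b)     → there₄ (here (∈-map⁺ spell (complete finiteLetter b)))
      (popˡ x)      → there₄ (there (here (∈-map⁺ popˡ (complete finiteCell x))))
      (popʳ x)      → there₄ (there₂ (here (∈-map⁺ popʳ (complete finiteCell x))))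
      (step p a)    → there₄ (there₂ (there (here
        (∈-cartesianProductWith⁺ step (complete Q p) (complete G a)))))
      (fetchˡ p x)  → there₈ (here
        (∈-cartesianProductWith⁺ fetchˡ (complete Q p) (complete finiteCell x)))
      (fetchʳ p x)  → there₈ (there (here
        (∈-cartesianProductWith⁺ fetchʳ (complete Q p) (complete finiteCell x))))

  symbol : Letter → Γ
  symbol b = just (inj₁ b)

  cell : Letter → Cell
  cell b = plain (symbol b)

  -- What a letter x pushed on the left contributes to the encoding of a
  -- literal.
  code : Cell → List Letter
  code x = ‵\\ ∷ encodeTerm (var (index finiteCell x))

  -- The written symbol goes to the stack behind the head; the fetching state then pops the new head
  -- symbol from the other stack.
  outcome : Action (Fin states) Γ → Literal Cell State
  outcome (halt true)     = [] ⟫ accepting ⟪ []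
  outcome (halt false)    = [] ⟫ rejecting ⟪ []
  outcome (go p a left)   = [] ⟫ fetchingˡ p ⟪ [ plain a ]
  outcome (go p a right)  = [ plain a ] ⟫ fetchingʳ p ⟪ []

  arriveˡ arriveʳ : Fin states → Cell → Literal Cell State
  arriveˡ p #          = [ # ] ⟫ at p nothing ⟪ []
  arriveˡ p (plain a)  = [] ⟫ at p a ⟪ []
  arriveˡ p (primed b) = [] ⟫ at p (symbol b) ⟪ []
  arriveʳ p #          = [] ⟫ at p nothing ⟪ [ # ]
  arriveʳ p (plain a)  = [] ⟫ at p a ⟪ []
  arriveʳ p (primed b) = [] ⟫ at p (symbol b) ⟪ []

  -- Both halves of the input are made from the left stack, each by a branch
  -- that consumes it: copying produces the second half, below an arbitrary
  -- primed word (padding), and spelling the first half, on top of an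
  -- arbitrary plain word (guessing); join intersects the two.
  clause : Rule → Clause Cell State
  clause load-copying  = [ [] ⟫ load ⟪ [] ] ⊢ [] ⟫ copying ⟪ []
  -- The last letter of the text is on top on the left, so moving letters one by one restores their
  -- order on the right.
  clause (copy b)      = [ [ cell b ] ⟫ copying ⟪ [] ] ⊢ [] ⟫ copying ⟪ [ cell b ]
  clause copy-end      = [ [ # ] ⟫ copying ⟪ [] ] ⊢ [] ⟫ padding ⟪ []
  clause (pad b)       = [ [] ⟫ padding ⟪ [] ] ⊢ [] ⟫ padding ⟪ [ primed b ]
  clause load-guessing = [ [] ⟫ load ⟪ [] ] ⊢ [] ⟫ guessing ⟪ []
  clause (guess b)     = [ [] ⟫ guessing ⟪ [] ] ⊢ [] ⟫ guessing ⟪ [ cell b ]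
  clause guess-end     = [ [] ⟫ guessing ⟪ [] ] ⊢ [] ⟫ spelling ⟪ []
  clause (spell b)     =
    [ [ cell b ] ⟫ spelling ⟪ [] ] ⊢ [] ⟫ spelling ⟪ map primed (code (cell b))
  clause spell-end     = [ [ # ] ⟫ spelling ⟪ [] ] ⊢ [] ⟫ spelled ⟪ map primed (code #)
  -- The premises share the right stack: `padding` fixes its plain half, `spelled` its primed half.
  -- The head starts on the first letter of the code, the outermost meet.
  clause join          =
    [] ⟫ padding ⟪ [] ∷ [] ⟫ spelled ⟪ [] ∷ [] ⊢ [ # ] ⟫ at start (symbol ‵∧) ⟪ []
  clause (step p a)    = [ [] ⟫ at p a ⟪ [] ] ⊢ outcome (δ p a)
  clause (fetchˡ p x)  = [ [ x ] ⟫ fetchingˡ p ⟪ [] ] ⊢ arriveˡ p x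
  clause (fetchʳ p x)  = [ [] ⟫ fetchingʳ p ⟪ [ x ] ] ⊢ arriveʳ p x
  -- The goal is `rejecting` with both stacks empty, so everything is discarded, markers included.
  clause (popˡ x)      = [ [ x ] ⟫ rejecting ⟪ [] ] ⊢ [] ⟫ rejecting ⟪ []
  clause (popʳ x)      = [ [] ⟫ rejecting ⟪ [ x ] ] ⊢ [] ⟫ rejecting ⟪ []

  initial : List Letter → Literal Cell State
  initial text = (# ∷ map cell text) ⟫ load ⟪ [ # ]

  spelling-of : List Letter → List Letter
  spelling-of text = concatMap code (map cell text)

  -- The shape of the encoded equation: the outermost meet, the left pushes of `#` and of the text,
  -- and a remainder, which is to be the text itself.
  input : List Letter → List Letter
  input text = ‵∧ ∷ (code # ++ spelling-of text) ++ text

  data Stack : List Cell → List Γ → Set where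
    #      : Stack [ # ] []
    plain  : ∀ {l ls} a → Stack l ls → Stack (plain a ∷ l) (a ∷ ls)
    primed : ∀ {l ls} b → Stack l ls → Stack (primed b ∷ l) (symbol b ∷ ls)

  stackˡ : List Letter → List Cell
  stackˡ xs = map cell xs ++ [ # ]

  stackʳ : List Letter → List Letter → List Cell
  stackʳ js ks = map primed js ++ stackˡ ks

  stackˡ-reverse : ∀ text → map cell text ʳ++ [ # ] ≡ stackˡ (reverse text)
  stackˡ-reverse text =
    trans (ʳ++-defn (map cell text)) (cong (_++ [ # ]) (sym (reverse-map cell text)))

  stackʳ-++ : ∀ is js ks → map primed is ++ stackʳ js ks ≡ stackʳ (is ++ js) ks
  stackʳ-++ is js ks =
    trans (sym (++-assoc (map primed is) (map primed js) _))
      (cong (_++ stackˡ ks) (sym (map-++ primed is js)))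

  stackʳ-Stack : ∀ js ks → Stack (stackʳ js ks) (map symbol (js ++ ks))
  stackʳ-Stack []       []       = #
  stackʳ-Stack []       (k ∷ ks) = plain (symbol k) (stackʳ-Stack [] ks)
  stackʳ-Stack (j ∷ js) ks       = primed j (stackʳ-Stack js ks)

  -- A rejecting run derives the goal

  module Rejection {ℓ} (I : Family Cell State ℓ) (closed : Closed clause I) where

    private
      cleanˡ : ∀ l → I rejecting l [] → I rejecting [] []
      cleanˡ []      h = h
      cleanˡ (x ∷ l) h = cleanˡ l (closed (popˡ x) l [] (h ∷ []))

      clean : ∀ l r → I rejecting l r → I rejecting [] []
      clean l []      h = cleanˡ l h
      clean l (x ∷ r) h = clean l r (closed (popʳ x) l r (h ∷ []))

      stepped : ∀ {p a act} l r → δ p a ≡ act → I (at p a) l r → Holds I l r (outcome act)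
      stepped l r eq h =
        subst (Holds I l r ∘ outcome) eq (closed (step _ _) l r (h ∷ []))

    open Tape

    run : ∀ {p t l r} → HaltsFrom M p t false → Stack l (leftOfHead t) → Stack r (rightOfHead t) →
          I (at p (atHead t)) l r → I rejecting [] []
    run {l = l} {r} (now eq) S T h = clean l r (stepped l r eq h)
    -- This side is exhausted: `shift` supplies a blank, and so does the marker, which stays in
    -- place.
    run {l = l} {r} (later {q′ = p} {d = left} eq H) S@# T h =
      run H S (plain _ T) (closed (fetchˡ p #) _ _ (stepped l r eq h ∷ []))
    run {l = l} {r} (later {q′ = p} {d = left} eq H) (plain a S) T h =
      run H S (plain _ T) (closed (fetchˡ p (plain a)) _ _ (stepped l r eq h ∷ []))
    run {l = l} {r} (later {q′ = p} {d = left} eq H) (primed b S) T h =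
      run H S (plain _ T) (closed (fetchˡ p (primed b)) _ _ (stepped l r eq h ∷ []))
    run {l = l} {r} (later {q′ = p} {d = right} eq H) S T@# h =
      run H (plain _ S) T (closed (fetchʳ p #) _ _ (stepped l r eq h ∷ []))
    run {l = l} {r} (later {q′ = p} {d = right} eq H) S (plain a T) h =
      run H (plain _ S) T (closed (fetchʳ p (plain a)) _ _ (stepped l r eq h ∷ []))
    run {l = l} {r} (later {q′ = p} {d = right} eq H) S (primed b T) h =
      run H (plain _ S) T (closed (fetchʳ p (primed b)) _ _ (stepped l r eq h ∷ []))

    private
      copied : ∀ xs ys → I copying (stackˡ xs) (stackˡ ys) → I padding [] (stackˡ (xs ʳ++ ys))
      copied []       ys h = closed copy-end [] _ (h ∷ [])
      copied (x ∷ xs) ys h = copied xs (x ∷ ys) (closed (copy x) _ _ (h ∷ []))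

      padded : ∀ js {ks} → I padding [] (stackˡ ks) → I padding [] (stackʳ js ks)
      padded []       h = h
      padded (j ∷ js) h = closed (pad j) _ _ (padded js h ∷ [])

      guessed : ∀ {l} ks → I guessing l [ # ] → I guessing l (stackˡ ks)
      guessed []       h = h
      guessed (k ∷ ks) h = closed (guess k) _ _ (guessed ks h ∷ [])

      spelt : ∀ xs ys ks → I spelling (stackˡ xs) (stackʳ (spelling-of ys) ks) →
              I spelled [] (stackʳ (code # ++ spelling-of (xs ʳ++ ys)) ks)
      spelt []       ys ks h =
        subst (I spelled []) (stackʳ-++ (code #) (spelling-of ys) ks) (closed spell-end [] _ (h ∷ []))
      spelt (x ∷ xs) ys ks h = spelt xs (x ∷ ys) ks
        (subst (I spelling (stackˡ xs)) (stackʳ-++ (code (cell x)) (spelling-of ys) ks)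
          (closed (spell x) _ _ (h ∷ [])))

    -- With the spelled code chosen as padding and the text as guess, both branches reach the same
    -- right stack, as `join` demands.
    rejects⇒rejecting : ∀ text → Rejects M (input text) → Holds I [] [] (initial text) →
                        I rejecting [] []
    rejects⇒rejecting text H h = run H # (stackʳ-Stack (code # ++ spelling-of text) text) started
      where
      loaded : I load (stackˡ (reverse text)) [ # ]
      loaded = subst (λ l → I load l [ # ]) (stackˡ-reverse text) h

      restore : ∀ {A : List Letter → Set ℓ} → A (reverse text ʳ++ []) → A text
      restore {A} = subst A (reverse-involutive text)

      padded-text : I padding [] (stackʳ (code # ++ spelling-of text) text)
      padded-text = padded (code # ++ spelling-of text)
        (restore {λ t → I padding [] (stackˡ t)}
          (copied (reverse text) [] (closed load-copying _ _ (loaded ∷ []))))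

      spelled-text : I spelled [] (stackʳ (code # ++ spelling-of text) text)
      spelled-text = restore {λ t → I spelled [] (stackʳ (code # ++ spelling-of t) text)}
        (spelt (reverse text) [] text (closed guess-end _ _
          (guessed text (closed load-guessing _ _ (loaded ∷ [])) ∷ [])))

      started : I (at start (symbol ‵∧)) [ # ] (stackʳ (code # ++ spelling-of text) text)
      started = closed join [] _ (padded-text ∷ spelled-text ∷ [])

  -- Without a rejecting run, a closed family omits the goal

  module Safety (text : List Letter) (¬rejects : ¬ Rejects M (input text)) where

    Safe : Fin states → Tape auxiliary → Set
    Safe p t = ¬ HaltsFrom M p t false

    -- The tape after a move, when the new head symbol is still on a stack.
    enterˡ enterʳ : List Γ → List Γ → Tape auxiliary
    enterˡ []       rs = tape [] nothing rs
    enterˡ (a ∷ ls) rs = tape ls a rs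
    enterʳ ls []       = tape ls nothing []
    enterʳ ls (a ∷ rs) = tape ls a rs

    Stacks : List Cell → List Cell → (List Γ → List Γ → Set) → Set
    Stacks l r P = ∃[ ls ] ∃[ rs ] Stack l ls × Stack r rs × P ls rs

    -- The lists `js` and `ks` record the free choices of padding and guessing. `rejecting` can be
    -- empty because simulated tapes are required to be safe.
    Invariant : Family Cell State 0ℓ
    Invariant load          l r = l ≡ stackˡ (reverse text) × r ≡ [ # ]
    Invariant copying       l r = ∃[ xs ] ∃[ ys ] l ≡ stackˡ xs × r ≡ stackˡ ys × xs ʳ++ ys ≡ text
    Invariant padding       l r = l ≡ [] × ∃[ js ] r ≡ stackʳ js text
    Invariant guessing      l r = l ≡ stackˡ (reverse text) × ∃[ ks ] r ≡ stackˡ ks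
    Invariant spelling      l r =
      ∃[ xs ] ∃[ ys ] ∃[ ks ] l ≡ stackˡ xs × r ≡ stackʳ (spelling-of ys) ks × xs ʳ++ ys ≡ text
    Invariant spelled       l r = l ≡ [] × ∃[ ks ] r ≡ stackʳ (code # ++ spelling-of text) ks
    Invariant rejecting     l r = Empty
    Invariant accepting     l r = Unit
    Invariant (at p a)      l r = Stacks l r λ ls rs → Safe p (tape ls a rs)
    Invariant (fetchingˡ p) l r = Stacks l r λ ls rs → Safe p (enterˡ ls rs)
    Invariant (fetchingʳ p) l r = Stacks l r λ ls rs → Safe p (enterʳ ls rs)

    private
      stackˡ-injective : ∀ xs ys → stackˡ xs ≡ stackˡ ys → xs ≡ ys
      stackˡ-injective []       []       _    = refl
      stackˡ-injective (x ∷ xs) (y ∷ ys) eq with refl ← ∷-injectiveˡ eq =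
        cong (x ∷_) (stackˡ-injective xs ys (∷-injectiveʳ eq))

      -- Primes mark where the first half ends; this is why letters come in two copies.
      stackʳ-injective : ∀ js js′ ks ks′ → stackʳ js ks ≡ stackʳ js′ ks′ → js ≡ js′ × ks ≡ ks′
      stackʳ-injective []       []         ks ks′ eq = refl , stackˡ-injective ks ks′ eq
      stackʳ-injective []       (j ∷ js′) []      ks′ ()
      stackʳ-injective []       (j ∷ js′) (k ∷ ks) ks′ ()
      stackʳ-injective (j ∷ js) []        ks []       ()
      stackʳ-injective (j ∷ js) []        ks (k ∷ ks′) ()
      stackʳ-injective (j ∷ js) (j′ ∷ js′) ks ks′ eq
        with refl ← ∷-injectiveˡ eq | refl , refl ← stackʳ-injective js js′ ks ks′ (∷-injectiveʳ eq) =
        refl , refl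

      shift-left : ∀ ls a rs → shift left (tape ls a rs) ≡ enterˡ ls (a ∷ rs)
      shift-left []       a rs = refl
      shift-left (_ ∷ ls) a rs = refl

      shift-right : ∀ ls a rs → shift right (tape ls a rs) ≡ enterʳ (a ∷ ls) rs
      shift-right ls a []       = refl
      shift-right ls a (_ ∷ rs) = refl

      -- A rejecting run from the next tape would extend to one from the present tape.
      step-safe : ∀ {p a} act l r → δ p a ≡ act → Invariant (at p a) l r →
                  Holds Invariant l r (outcome act)
      step-safe (halt true)  l r eq _ = tt
      step-safe (halt false) l r eq (_ , _ , _ , _ , safe) = safe (now eq)
      step-safe (go p a left) l r eq (ls , rs , S , T , safe) =
        ls , a ∷ rs , S , plain a T ,
        λ H → safe (later eq (subst (λ t → HaltsFrom M p t false) (sym (shift-left ls a rs)) H))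
      step-safe (go p a right) l r eq (ls , rs , S , T , safe) =
        a ∷ ls , rs , plain a S , T ,
        λ H → safe (later eq (subst (λ t → HaltsFrom M p t false) (sym (shift-right ls a rs)) H))

    Invariant-closed : Closed clause Invariant
    Invariant-closed load-copying l r ((refl , refl) ∷ []) =
      reverse text , [] , refl , refl , reverse-involutive text
    Invariant-closed (copy b) l r ((x ∷ xs , ys , refl , refl , eq) ∷ []) =
      xs , x ∷ ys , refl , refl , eq
    Invariant-closed copy-end l r (([] , ys , refl , refl , refl) ∷ []) = refl , [] , refl
    Invariant-closed (pad b) l r ((refl , js , refl) ∷ []) = refl , b ∷ js , refl
    Invariant-closed load-guessing l r ((refl , refl) ∷ []) = refl , [] , refl
    Invariant-closed (guess b) l r ((refl , ks , refl) ∷ []) = refl , b ∷ ks , refl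
    Invariant-closed guess-end l r ((refl , ks , refl) ∷ []) =
      reverse text , [] , ks , refl , refl , reverse-involutive text
    Invariant-closed (spell b) l r ((x ∷ xs , ys , ks , refl , refl , eq) ∷ []) =
      xs , x ∷ ys , ks , refl , stackʳ-++ (code (cell b)) (spelling-of ys) ks , eq
    Invariant-closed spell-end l r (([] , ys , ks , refl , refl , refl) ∷ []) =
      refl , ks , stackʳ-++ (code #) (spelling-of ys) ks
    -- Comparing the two descriptions of the right stack forces the arbitrary padding `js` to be the
    -- spelled code, so the tape is that of `input text`.
    Invariant-closed join l r ((refl , js , refl) ∷ (_ , ks , eq) ∷ [])
      with refl , _ ← stackʳ-injective js (code # ++ spelling-of text) text ks eq =
      [] , _ , # , stackʳ-Stack js text , ¬rejects
    Invariant-closed (step p a) l r (h ∷ []) = step-safe (δ p a) l r refl h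
    Invariant-closed (fetchˡ p _) l r ((_ , rs , # , T , safe) ∷ []) = [] , rs , # , T , safe
    Invariant-closed (fetchˡ p _) l r ((_ , rs , plain a S , T , safe) ∷ []) = _ , rs , S , T , safe
    Invariant-closed (fetchˡ p _) l r ((_ , rs , primed b S , T , safe) ∷ []) = _ , rs , S , T , safe
    Invariant-closed (fetchʳ p _) l r ((ls , _ , S , # , safe) ∷ []) = ls , [] , S , # , safe
    Invariant-closed (fetchʳ p _) l r ((ls , _ , S , plain a T , safe) ∷ []) = ls , _ , S , T , safe
    Invariant-closed (fetchʳ p _) l r ((ls , _ , S , primed b T , safe) ∷ []) = ls , _ , S , T , safe
    Invariant-closed (popˡ x) l r (() ∷ [])
    Invariant-closed (popʳ x) l r (() ∷ [])

    Invariant-initial : Holds Invariant [] [] (initial text)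
    Invariant-initial = stackˡ-reverse text , refl

  -- The equation about its own code, and undecidability

  open Clauses finiteCell finiteState finiteRule clause

  -- The encoded equation from the state load onwards; the text pushed on
  -- the left stack does not occur in it, so it can be taken as that text.
  ownText : List Letter
  ownText = encodeTerm (resʳ [ # ] (var (index finiteState load))) ++
    encodeTerm (background rejecting) ++ ‵= ∷ ‵⊥ ∷ []

  ownEquation : Equation
  ownEquation = equation (initial ownText) rejecting

  encode-resˡ : ∀ u t → encodeTerm (resˡ u t) ≡ concatMap code u ++ encodeTerm t
  encode-resˡ []      t = refl
  encode-resˡ (a ∷ u) t = cong (‵\\ ∷_)
    (trans (cong (encodeTerm (letter a) ++_) (encode-resˡ u t))
      (sym (++-assoc (encodeTerm (letter a)) (concatMap code u) (encodeTerm t))))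

  -- Reassociation exposes what follows the left pushes in the code, and this suffix is `ownText` by
  -- definition.
  encode-ownEquation : encode ownEquation ≡ input ownText
  encode-ownEquation = cong (‵∧ ∷_) (begin
    (encodeTerm (resˡ u t) ++ encodeTerm d) ++ end  ≡⟨ ++-assoc (encodeTerm (resˡ u t)) (encodeTerm d) end ⟩
    encodeTerm (resˡ u t) ++ rest                   ≡⟨ cong (_++ rest) (encode-resˡ u t) ⟩
    (concatMap code u ++ encodeTerm t) ++ rest      ≡⟨ ++-assoc (concatMap code u) (encodeTerm t) rest ⟩
    concatMap code u ++ ownText                     ∎)
    where
    open ≡-Reasoning
    u : List Cell
    u = # ∷ map cell ownText
    t d : Term
    t = resʳ [ # ] (var (index finiteState load))
    d = background rejecting
    end rest : List Letter
    end = ‵= ∷ ‵⊥ ∷ []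
    rest = encodeTerm d ++ end

  rejects⇒valid : ∀ {c ℓ} → Rejects M (encode ownEquation) → EquationalTheory c ℓ ownEquation
  rejects⇒valid R = sound (initial ownText) rejecting λ I closed →
    Rejection.rejects⇒rejecting I closed ownText (subst (Rejects M) encode-ownEquation R)

  -- If `M` did not reject, `Invariant` would be a closed family containing the initial fact and
  -- omitting the goal, against completeness.
  valid⇒¬¬rejects : ∀ {c ℓ} → EquationalTheory c ℓ ownEquation → ¬ ¬ Rejects M (encode ownEquation)
  valid⇒¬¬rejects {c} {ℓ} valid ¬R =
    Completeness.complete-for Invariant Invariant-closed c ℓ (initial ownText) rejecting valid
      Invariant-initial id
    where open Safety ownText (¬R ∘ subst (Rejects M) (sym encode-ownEquation))

halting-deterministic : ∀ M {p t} → HaltsFrom M p t true → ¬ HaltsFrom M p t false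
halting-deterministic M (now eq) (now eq′) with () ← trans (sym eq) eq′
halting-deterministic M (now eq) (later eq′ _) with () ← trans (sym eq) eq′
halting-deterministic M (later eq _) (now eq′) with () ← trans (sym eq) eq′
halting-deterministic M (later eq H) (later eq′ H′) with refl ← trans (sym eq) eq′ =
  halting-deterministic M H H′

theorem2p14 : (c ℓ : Level) → ¬ TuringDecidable encode (EquationalTheory c ℓ)
-- A valid equation would be accepted, hence by determinism not rejected, contradicting
-- `valid⇒¬¬rejects`. So it is invalid and `M` rejects it, which makes it valid.
theorem2p14 c ℓ (M , decides) = invalid (rejects⇒valid (proj₂ (decides ownEquation) invalid))
  where
  open Simulation M
  invalid : ¬ EquationalTheory c ℓ ownEquation
  invalid valid =
    valid⇒¬¬rejects valid (halting-deterministic M (proj₁ (decides ownEquation) valid))
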